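{- Let $\Gamma$ be a graph with $P_3\leq\Gamma$ and let $v$ be a positive integer such that there exists a $(K_v,\Gamma)$-design. Then \[\eta_1(v)\leq\eta_2(v)\leq v+3.\]
   Context: All graphs are finite and simple; $\Gamma\leq K$ means $\Gamma$ is a subgraph of $K$ (or is isomorphic to one, when $\Gamma$ is an abstract graph). $P_3$ is the path on $3$ vertices. For a graph $K$ and $\Gamma\leq K$, a $(K,\Gamma)$-design is a set $\mathcal{B}$ of subgraphs of $K$, called blocks, each isomorphic to $\Gamma$, whose edge-sets partition $E(K)$. $K_n$ is the complete graph on a set of $n$ vertices (any $n$-element vertex set may be used); a $\Gamma$-design of order $n$ is a $(K_n,\Gamma)$-design. Given $\Gamma'\leq\Gamma$, a $(K,\Gamma)$-design $\mathcal{B}$ and a $(K',\Gamma')$-design $\mathcal{B}'$, a down-link from $\mathcal{B}$ to $\mathcal{B}'$ is a function $f:\mathcal{B}\to\mathcal{B}'$ such that $f(B)$ is a subgraph of $B$ for every $B\in\mathcal{B}$ (the vertex sets of $K$ and $K'$ need not coincide, and either may be the larger). Take $\Gamma'=P_3$. For $v$ such that a $(K_v,\Gamma)$-design exists: $\mathcal{L}_1\Gamma(v)$ is the set of all integers $n$ such that some $\Gamma$-design of order $v$ can be down-linked to a $P_3$-design of order $n$; $\mathcal{L}_2\Gamma(v)$ is the set of all integers $n$ such that every $\Gamma$-design of order $v$ can be down-linked to a $P_3$-design of order $n$. Put $\eta_i(v)=\inf\mathcal{L}_i\Gamma(v)$ for $i=1,2$. -}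

module Defs where

open import Level using (0ℓ; suc)
open import Data.Fin using (Fin)
open import Data.List using (List; []; _∷_; length)
open import Data.List.Membership.Propositional using (_∈_)
open import Data.List.Membership.DecPropositional as DecMembership using ()
open import Data.List.Relation.Binary.Subset.Propositional using (_⊆_)
open import Data.List.Relation.Unary.All using ([]; _∷_)
open import Data.List.Relation.Unary.AllPairs using ([]; _∷_)
open import Data.List.Relation.Unary.Any using (here; there)
open import Data.List.Relation.Unary.Unique.Propositional using (Unique)
open import Data.Nat using (ℕ; _≤_; _<_; _≟_)
open import Data.Nat.Induction using (<-rec)
open import Data.Nat.Properties using (≮⇒≥; ≤-antisym)
open import Data.Product using (Σ-syntax; ∃-syntax; ∃!; _×_; _,_)
open import Function using (_∘_)
open import Relation.Binary using (Rel; Decidable; Symmetric; Irreflexive; _⇒_)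
open import Relation.Binary.Construct.Add.Supremum.NonStrict _≤_ as Sup using ()
open import Relation.Binary.PropositionalEquality using (_≡_; _≢_; refl)
open import Relation.Nullary using (¬_; yes; no; contradiction)
open import Relation.Nullary.Construct.Add.Supremum using (_⁺; ⊤⁺; [_])
open import Relation.Nullary.Decidable using (_×-dec_; ¬?)
open import Relation.Unary using (Pred)

record FinSet : Set where
  constructor _,_
  field
    elements : List ℕ
    unique   : Unique elements

open FinSet public

card : FinSet → ℕ
card = length ∘ elements

-- All vertices are drawn from the common countably infinite set ℕ, so that
-- graphs with different vertex sets can be compared by the subgraph relation.
record Graph : Set₁ where
  field
    vertices : FinSet
    Edge     : Rel ℕ 0ℓ
    edge?    : Decidable Edge
    symm     : Symmetric Edge
    irrefl   : Irreflexive _≡_ Edge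
    -- By symm, the other endpoint is a vertex as well.
    support  : ∀ {x y} → Edge x y → x ∈ elements vertices

open Graph public

V : Graph → List ℕ
V G = elements (vertices G)

infix 4 _⊑_ _≈ᴳ_ _≅_ _≲_

record _⊑_ (H G : Graph) : Set where
  field
    vertices⊆ : V H ⊆ V G
    edges⊆    : Edge H ⇒ Edge G

-- Equality of graphs: same vertex set and same edge set.
_≈ᴳ_ : Graph → Graph → Set
G ≈ᴳ H = G ⊑ H × H ⊑ G

-- Only the values of to on V G and of from on V H matter.
record _≅_ (G H : Graph) : Set where
  field
    to        : ℕ → ℕ
    from      : ℕ → ℕ
    to-∈      : ∀ {x} → x ∈ V G → to x ∈ V H
    from-∈    : ∀ {x} → x ∈ V H → from x ∈ V G
    from∘to   : ∀ {x} → x ∈ V G → from (to x) ≡ x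
    to∘from   : ∀ {x} → x ∈ V H → to (from x) ≡ x
    to-edge   : ∀ {x y} → Edge G x y → Edge H (to x) (to y)
    from-edge : ∀ {x y} → Edge H x y → Edge G (from x) (from y)

_≲_ : Graph → Graph → Set₁
Γ ≲ K = ∃[ H ] H ⊑ K × Γ ≅ H

K[_] : FinSet → Graph
K[ W ] = record
  { vertices = W
  ; Edge     = λ x y → x ∈ elements W × y ∈ elements W × x ≢ y
  ; edge?    = λ x y → (x ∈? elements W) ×-dec (y ∈? elements W) ×-dec ¬? (x ≟ y)
  ; symm     = λ (x∈ , y∈ , x≢y) → y∈ , x∈ , λ { refl → x≢y refl }
  ; irrefl   = λ { refl (_ , _ , x≢x) → x≢x refl }
  ; support  = λ (x∈ , _) → x∈
  }
  where open DecMembership _≟_ using (_∈?_)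

data P₃-Edge : Rel ℕ 0ℓ where
  0-1 : P₃-Edge 0 1
  1-0 : P₃-Edge 1 0
  1-2 : P₃-Edge 1 2
  2-1 : P₃-Edge 2 1

P₃ : Graph
P₃ = record
  { vertices = 0 ∷ 1 ∷ 2 ∷ []
             , ((λ ()) ∷ (λ ()) ∷ []) ∷ ((λ ()) ∷ []) ∷ [] ∷ []
  ; Edge     = P₃-Edge
  ; edge?    = dec
  ; symm     = λ { 0-1 → 1-0 ; 1-0 → 0-1 ; 1-2 → 2-1 ; 2-1 → 1-2 }
  ; irrefl   = λ { refl () }
  ; support  = λ { 0-1 → here refl
                 ; 1-0 → there (here refl)
                 ; 1-2 → there (here refl)
                 ; 2-1 → there (there (here refl)) }
  }
  where
  dec : Decidable P₃-Edge
  dec 0 0 = no λ ()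
  dec 0 1 = yes 0-1
  dec 0 (ℕ.suc (ℕ.suc _)) = no λ ()
  dec 1 0 = yes 1-0
  dec 1 1 = no λ ()
  dec 1 2 = yes 1-2
  dec 1 (ℕ.suc (ℕ.suc (ℕ.suc _))) = no λ ()
  dec 2 0 = no λ ()
  dec 2 1 = yes 2-1
  dec 2 (ℕ.suc (ℕ.suc _)) = no λ ()
  dec (ℕ.suc (ℕ.suc (ℕ.suc _))) _ = no λ ()

-- The set of blocks is given by an enumeration without repetitions.
record Design (K Γ : Graph) : Set₁ where
  field
    size      : ℕ
    block     : Fin size → Graph
    distinct  : ∀ {i j} → block i ≈ᴳ block j → i ≡ j
    block⊑    : ∀ i → block i ⊑ K
    block≅    : ∀ i → Γ ≅ block i
    partition : ∀ {x y} → Edge K x y → ∃! _≡_ λ i → Edge (block i) x y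

open Design public

DownLink : ∀ {K Γ K′ Γ′} → Design K Γ → Design K′ Γ′ → Set
DownLink 𝓑 𝓑′ = Σ[ f ∈ (Fin (size 𝓑) → Fin (size 𝓑′)) ]
                  (∀ i → block 𝓑′ (f i) ⊑ block 𝓑 i)

record DesignOfOrder (Γ : Graph) (n : ℕ) : Set₁ where
  field
    points : FinSet
    order  : card points ≡ n
    design : Design K[ points ] Γ

open DesignOfOrder public

LinksTo : ∀ {Γ v} → DesignOfOrder Γ v → ℕ → Set₁
LinksTo 𝓑 n = Σ[ 𝓟 ∈ DesignOfOrder P₃ n ] DownLink (design 𝓑) (design 𝓟)

𝓛₁ : Graph → ℕ → Pred ℕ (suc 0ℓ)
𝓛₁ Γ v n = Σ[ 𝓑 ∈ DesignOfOrder Γ v ] LinksTo 𝓑 n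

𝓛₂ : Graph → ℕ → Pred ℕ (suc 0ℓ)
𝓛₂ Γ v n = (𝓑 : DesignOfOrder Γ v) → LinksTo 𝓑 n

ℕ∞ : Set
ℕ∞ = ℕ ⁺

infix 4 _≤∞_

_≤∞_ : Rel ℕ∞ 0ℓ
_≤∞_ = Sup._≤⁺_

-- The greatest lower bound in ℕ ∪ {∞}; in particular the infimum of the empty
-- set is ∞.  It is unique, and exists up to double negation, for every L.
record IsInfimum {ℓ} (L : Pred ℕ ℓ) (η : ℕ∞) : Set ℓ where
  field
    lower    : ∀ {n} → L n → η ≤∞ [ n ]
    greatest : ∀ {y} → (∀ {n} → L n → y ≤∞ [ n ]) → y ≤∞ η

infimum-unique : ∀ {ℓ} {L : Pred ℕ ℓ} {η η′} →
                 IsInfimum L η → IsInfimum L η′ → η ≡ η′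
infimum-unique p q = Sup.≤⁺-antisym-≡ ≤-antisym
  (IsInfimum.greatest q (IsInfimum.lower p))
  (IsInfimum.greatest p (IsInfimum.lower q))

infimum-exists : ∀ {ℓ} (L : Pred ℕ ℓ) → ¬ ¬ (∃[ η ] IsInfimum L η)
infimum-exists L ¬inf = ¬inf (⊤⁺ , record
  { lower    = λ {n} l → contradiction l (empty n)
  ; greatest = λ _ → _ Sup.≤⊤⁺ })
  where
  empty : ∀ n → ¬ L n
  empty = <-rec (λ n → ¬ L n) λ n rec l → ¬inf ([ n ] , record
    { lower    = λ l′ → Sup.[ ≮⇒≥ (λ m<n → rec m<n l′) ]
    ; greatest = λ below → below l })

{-# OPTIONS --safe #-}
-- A cherry chosen in every block gives a family of edge-disjoint cherries in
-- K_v.  Add one or three new points, so that the number of edges becomes even,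
-- and let ∞ be one of them.  At every point x other than ∞, pair up the
-- uncovered edges joining x to the points after it; if one edge is left over,
-- pair it with the edge from x to ∞.  Now only edges at ∞ remain, and by parity
-- an even number of them, so they can be paired up as well.
module Submission where

open import Defs
open import Data.Fin using (Fin; zero; suc)
open import Data.List using (List; []; _∷_; _++_; length; map; concatMap; filter; lookup; tabulate)
open import Data.List.Extrema.Nat using (max; xs≤max)
open import Data.List.Membership.DecPropositional as DecMembership using ()
open import Data.List.Membership.Propositional using (_∈_; _∉_; find; lose)
open import Data.List.Membership.Propositional.Properties
  using (∈-++⁺ˡ; ∈-++⁺ʳ; ∈-++⁻; ∈-map⁺; ∈-map⁻; ∈-filter⁺; ∈-filter⁻; ∈-concatMap⁺; ∈-concatMap⁻; ∈-lookup; ∈-tabulate⁺; ∈-tabulate⁻)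
open import Data.List.Membership.Propositional.Properties.WithK using (unique∧set⇒bag)
open import Data.List.Properties using (length-map; length-++; filter-++; concatMap-++)
open import Data.List.Relation.Binary.BagAndSetEquality using (∼bag⇒↭)
open import Data.List.Relation.Binary.Disjoint.Propositional using (Disjoint)
open import Data.List.Relation.Binary.Permutation.Propositional
  using (_↭_; refl; prep; ↭-sym; ↭-trans; ↭⇒↭ₛ; module PermutationReasoning)
open import Data.List.Relation.Binary.Permutation.Propositional.Properties
  using (∈-resp-↭; ↭-length; ++⁺; ++⁺ˡ; ++⁺ʳ; shift; shifts)
open import Data.List.Relation.Binary.Permutation.Setoid.Properties using (Unique-resp-↭)
open import Data.List.Relation.Binary.Subset.Propositional using (_⊆_)
open import Data.List.Relation.Unary.All as All using (All; []; _∷_)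
import Data.List.Relation.Unary.All.Properties as All
open import Data.List.Relation.Unary.AllPairs using ([]; _∷_)
import Data.List.Relation.Unary.AllPairs.Properties as AllPairs
open import Data.List.Relation.Unary.Any using (here; there; index)
open import Data.List.Relation.Unary.Any.Properties using (lookup-index)
open import Data.List.Relation.Unary.Unique.Propositional using (Unique)
import Data.List.Relation.Unary.Unique.Propositional.Properties as Unique
open import Data.Nat using (ℕ; zero; suc; _+_; _*_; _<_; _≤_; z≤n; s≤s; _⊓_; _⊔_; _≟_)
open import Data.Nat.Divisibility using (_∣_; divides; _∣0; ∣-refl; ∣m∣n⇒∣m+n; ∣m+n∣m⇒∣n; ∣⇒≤; m∣m*n)
open import Data.Nat.Properties
  using (⊓-comm; ⊔-comm; ≤-total; ≤-trans; ≤-reflexive; m≤n⇒m⊓n≡m; m≥n⇒m⊓n≡n; m≤n⇒m⊔n≡n; m≥n⇒m⊔n≡m; >⇒≢; +-comm; +-monoʳ-≤)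
open import Data.Nat.Tactic.RingSolver using (solve-∀)
open import Data.Product using (∃-syntax; ∃₂; _×_; _,_; proj₁; proj₂)
open import Data.Product.Properties using (≡-dec)
open import Data.Sum using (_⊎_; inj₁; inj₂; [_,_]′; map₂)
open import Function using (_∘_; mk⇔)
open import Level using (0ℓ)
open import Relation.Binary.Construct.Add.Supremum.NonStrict _≤_ as Sup using ()
open import Relation.Binary.PropositionalEquality
  using (_≡_; _≢_; refl; sym; trans; cong; cong₂; subst; setoid)
open import Relation.Nullary using (¬_; yes; no; contradiction)
open import Relation.Nullary.Construct.Add.Supremum using ([_])
open import Relation.Nullary.Decidable using (¬?)
open import Relation.Unary using (Pred; Decidable)

-- Edges of a complete graph as a list

-- Unordered pairs are represented by their sorted ordered pairs.
edge : ℕ → ℕ → ℕ × ℕ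
edge x y = x ⊓ y , x ⊔ y

edge-comm : ∀ x y → edge x y ≡ edge y x
edge-comm x y = cong₂ _,_ (⊓-comm x y) (⊔-comm x y)

edge-sorted : ∀ x y → edge x y ≡ (x , y) ⊎ edge x y ≡ (y , x)
edge-sorted x y with ≤-total x y
... | inj₁ x≤y = inj₁ (cong₂ _,_ (m≤n⇒m⊓n≡m x≤y) (m≤n⇒m⊔n≡n x≤y))
... | inj₂ y≤x = inj₂ (cong₂ _,_ (m≥n⇒m⊓n≡n y≤x) (m≥n⇒m⊔n≡m y≤x))

edge-injective : ∀ {x y x′ y′} → edge x y ≡ edge x′ y′ →
                 (x ≡ x′ × y ≡ y′) ⊎ (x ≡ y′ × y ≡ x′)
edge-injective {x} {y} {x′} {y′} eq with edge-sorted x y | edge-sorted x′ y′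
... | inj₁ p | inj₁ q with refl ← trans (sym p) (trans eq q) = inj₁ (refl , refl)
... | inj₁ p | inj₂ q with refl ← trans (sym p) (trans eq q) = inj₂ (refl , refl)
... | inj₂ p | inj₁ q with refl ← trans (sym p) (trans eq q) = inj₂ (refl , refl)
... | inj₂ p | inj₂ q with refl ← trans (sym p) (trans eq q) = inj₁ (refl , refl)

edge-injectiveʳ : ∀ {x y z} → edge x y ≡ edge x z → y ≡ z
edge-injectiveʳ eq with edge-injective eq
... | inj₁ (_ , y≡z)    = y≡z
... | inj₂ (refl , y≡x) = y≡x

Edge-resp-edge : ∀ G {x y x′ y′} → edge x y ≡ edge x′ y′ → Edge G x y → Edge G x′ y′
Edge-resp-edge G eq e with edge-injective eq
... | inj₁ (refl , refl) = e
... | inj₂ (refl , refl) = symm G e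

open DecMembership (≡-dec _≟_ _≟_) using (_∈?_)

-- Each edge goes to the star of whichever endpoint comes earlier in the list; `reduceToStar` peels
-- off one such star at a time.
allEdges : List ℕ → List (ℕ × ℕ)
allEdges []       = []
allEdges (x ∷ xs) = map (edge x) xs ++ allEdges xs

∈-allEdges⁺ : ∀ {W x y} → x ∈ W → y ∈ W → x ≢ y → edge x y ∈ allEdges W
∈-allEdges⁺ (here refl) (here refl) x≢x = contradiction refl x≢x
∈-allEdges⁺ {w ∷ W} (here refl) (there y∈W) _ = ∈-++⁺ˡ (∈-map⁺ (edge w) y∈W)
∈-allEdges⁺ {w ∷ W} {x} (there x∈W) (here refl) _ =
  subst (_∈ allEdges (w ∷ W)) (edge-comm w x) (∈-++⁺ˡ (∈-map⁺ (edge w) x∈W))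
∈-allEdges⁺ {w ∷ W} (there x∈W) (there y∈W) x≢y =
  ∈-++⁺ʳ (map (edge w) W) (∈-allEdges⁺ x∈W y∈W x≢y)

∈-allEdges⁻ : ∀ {W} (W! : Unique W) {x y} → edge x y ∈ allEdges W → Edge K[ W , W! ] x y
∈-allEdges⁻ {w ∷ W} (w∉W ∷ W!) e∈ with ∈-++⁻ (map (edge w) W) e∈
... | inj₁ e∈star with z , z∈W , eq ← ∈-map⁻ (edge w) e∈star =
  Edge-resp-edge K[ w ∷ W , w∉W ∷ W! ] (sym eq) (here refl , there z∈W , All.lookup w∉W z∈W)
... | inj₂ e∈rest with x∈ , y∈ , x≢y ← ∈-allEdges⁻ W! e∈rest = there x∈ , there y∈ , x≢y

allEdges-unique : ∀ {W} → Unique W → Unique (allEdges W)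
allEdges-unique []                  = []
allEdges-unique {w ∷ W} (w∉W ∷ W!) =
  Unique.++⁺ (Unique.map⁺ edge-injectiveʳ W!) (allEdges-unique W!) disjoint
  where
  disjoint : Disjoint (map (edge w) W) (allEdges W)
  disjoint (e∈star , e∈rest) with z , _ , refl ← ∈-map⁻ (edge w) e∈star =
    All.lookup w∉W (proj₁ (∈-allEdges⁻ W! e∈rest)) refl

-- The binomial coefficient of n over 2, unfolded along the recursion of `allEdges`.
triangle : ℕ → ℕ
triangle zero    = 0
triangle (suc n) = n + triangle n

length-allEdges : ∀ W → length (allEdges W) ≡ triangle (length W)
length-allEdges []      = refl
length-allEdges (w ∷ W) = trans (length-++ (map (edge w) W))
                                (cong₂ _+_ (length-map (edge w) W) (length-allEdges W))

-- Splitting stars into cherries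

record Cherry : Set where
  constructor cherry
  field
    left centre right : ℕ

open Cherry

cherryEdges : Cherry → List (ℕ × ℕ)
cherryEdges c = edge (centre c) (left c) ∷ edge (centre c) (right c) ∷ []

edges : List Cherry → List (ℕ × ℕ)
edges = concatMap cherryEdges

length-edges : ∀ C → length (edges C) ≡ length C * 2
length-edges []      = refl
length-edges (_ ∷ C) = cong (2 +_) (length-edges C)

Star : ℕ → List (ℕ × ℕ) → Set
Star c = All (λ e → ∃[ y ] e ≡ edge c y)

map-edge-star : ∀ c ys → Star c (map (edge c) ys)
map-edge-star c ys = All.map⁺ (All.universal (λ y → y , refl) ys)

-- Edges with the common end `c` form cherries two by two. An odd edge is returned with its other
-- end `y`, because `reduceToStar` completes it by an edge to `∞`.
pairUp : ∀ {c es} → Star c es →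
         (∃[ C ] edges C ↭ es) ⊎ (∃₂ λ y C → edge c y ∷ edges C ↭ es)
pairUp []                = inj₁ ([] , refl)
pairUp ((y , refl) ∷ []) = inj₂ (y , [] , refl)
pairUp {c} ((y , refl) ∷ (z , refl) ∷ es) with pairUp es
... | inj₁ (C , p)     = inj₁ (cherry y c z ∷ C , prep _ (prep _ p))
... | inj₂ (x , C , p) = inj₂ (x , cherry y c z ∷ C ,
        ↭-trans (↭-sym (shift _ (_ ∷ _ ∷ []) _)) (prep _ (prep _ p)))

2∣length-edges : ∀ C → 2 ∣ length (edges C)
2∣length-edges C = divides (length C) (length-edges C)

2∤1 : ¬ 2 ∣ 1
2∤1 2∣1 with s≤s () ← ∣⇒≤ 2∣1

-- Cherries use two edges each, so a leftover edge would make the star odd.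
pairUp-even : ∀ {c es} → Star c es → 2 ∣ length es → ∃[ C ] edges C ↭ es
pairUp-even es-star even with pairUp es-star
... | inj₁ paired      = paired
... | inj₂ (_ , C , p) = contradiction
  (∣m+n∣m⇒∣n (subst (2 ∣_) (trans (sym (↭-length p)) (+-comm 1 _)) even) (2∣length-edges C))
  2∤1

-- Completing a family of cherries

++⁺-middle : ∀ {a} {A : Set a} (ws xs : List A) {ys zs ms ns} →
             xs ↭ ys → ws ++ zs ↭ ms ++ ns → ws ++ xs ++ zs ↭ ms ++ ys ++ ns
++⁺-middle ws xs {ys} {zs} {ms} {ns} p q = begin
  ws ++ xs ++ zs  ↭⟨ shifts ws xs ⟩
  xs ++ ws ++ zs  ↭⟨ ++⁺ p q ⟩
  ys ++ ms ++ ns  ↭⟨ shifts ys ms ⟩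
  ms ++ ys ++ ns  ∎
  where open PermutationReasoning

-- Each point `x` of `U` brings one edge to `∞`, and one is all that an odd star at `x` needs. The
-- edges not spent in this way are collected in `R`. `complete` takes `P` to mean not yet covered.
reduceToStar : ∀ {P : Pred (ℕ × ℕ) 0ℓ} (P? : Decidable P) ∞ U →
  ∃₂ λ C R → Star ∞ R × R ++ edges C ↭ map (edge ∞) U ++ filter P? (allEdges U)
reduceToStar P? ∞ [] = [] , [] , [] , refl
reduceToStar P? ∞ (x ∷ U)
  rewrite filter-++ P? (map (edge x) U) (allEdges U)
  with C , R , R-star , p ← reduceToStar P? ∞ U
  with pairUp (All.filter⁺ P? (map-edge-star x U))
-- The star at `x` pairs up by itself, so the edge to `∞` is left for `R`.
... | inj₁ (D , q) = D ++ C , edge ∞ x ∷ R , (x , refl) ∷ R-star , prep _ (begin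
  R ++ edges (D ++ C)      ≡⟨ cong (R ++_) (concatMap-++ cherryEdges D C) ⟩
  R ++ edges D ++ edges C  ↭⟨ ++⁺-middle R (edges D) {ms = map (edge ∞) U} q p ⟩
  _                        ∎)
  where open PermutationReasoning
-- The leftover edge to `y` and the edge to `∞` make a cherry centred at `x`, and `R` does not grow.
... | inj₂ (y , D , q) = cherry ∞ x y ∷ D ++ C , R , R-star , (begin
  R ++ edge x ∞ ∷ edge x y ∷ edges (D ++ C)
    ≡⟨ cong₂ (λ e E → R ++ e ∷ edge x y ∷ E) (edge-comm x ∞) (concatMap-++ cherryEdges D C) ⟩
  R ++ edge ∞ x ∷ edge x y ∷ edges D ++ edges C
    ↭⟨ shift (edge ∞ x) R _ ⟩
  edge ∞ x ∷ R ++ edge x y ∷ edges D ++ edges C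
    ↭⟨ prep _ (++⁺-middle R (edge x y ∷ edges D) {ms = map (edge ∞) U} q p) ⟩
  _ ∎)
  where open PermutationReasoning

-- Lists without repetitions that have the same members are equal as bags, hence permutations of
-- each other.
unique-⊆⇒↭ : ∀ {xs ys : List (ℕ × ℕ)} → Unique xs → Unique ys → xs ⊆ ys →
             xs ++ filter (¬? ∘ (_∈? xs)) ys ↭ ys
unique-⊆⇒↭ {xs} {ys} xs! ys! xs⊆ys =
  ∼bag⇒↭ (unique∧set⇒bag (Unique.++⁺ xs! (Unique.filter⁺ ∉xs? ys!) disjoint) ys! (mk⇔ to from))
  where
  ∉xs? = ¬? ∘ (_∈? xs)
  disjoint : Disjoint xs (filter ∉xs? ys)
  disjoint (x∈xs , x∈rest) = proj₂ (∈-filter⁻ ∉xs? {xs = ys} x∈rest) x∈xs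
  to : xs ++ filter ∉xs? ys ⊆ ys
  to x∈ with ∈-++⁻ xs x∈
  ... | inj₁ x∈xs   = xs⊆ys x∈xs
  ... | inj₂ x∈rest = proj₁ (∈-filter⁻ ∉xs? x∈rest)
  from : ys ⊆ xs ++ filter ∉xs? ys
  from {x} x∈ys with x ∈? xs
  ... | yes x∈xs = ∈-++⁺ˡ x∈xs
  ... | no  x∉xs = ∈-++⁺ʳ xs (∈-filter⁺ ∉xs? x∈ys x∉xs)

-- `Q` covers only edges inside `U`, so every edge at `∞` is still at the disposal of
-- `reduceToStar`, and only the parity of `R` is at stake.
complete : ∀ {Q ∞ U} → Unique (edges Q) → Unique U → edges Q ⊆ allEdges U →
           2 ∣ length (allEdges (∞ ∷ U)) → ∃[ C ] edges (Q ++ C) ↭ allEdges (∞ ∷ U)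
complete {Q} {∞} {U} Q! U! Q⊆U even
  with C , R , R-star , p ← reduceToStar (¬? ∘ (_∈? edges Q)) ∞ U
  = D ++ C , (begin
    edges (Q ++ D ++ C)            ≡⟨ concatMap-++ cherryEdges Q (D ++ C) ⟩
    edges Q ++ edges (D ++ C)      ≡⟨ cong (edges Q ++_) (concatMap-++ cherryEdges D C) ⟩
    edges Q ++ edges D ++ edges C  ↭⟨ ++⁺ˡ (edges Q) (++⁺ʳ (edges C) (proj₂ paired)) ⟩
    edges Q ++ R ++ edges C        ↭⟨ covers ⟩
    allEdges (∞ ∷ U)               ∎)
  where
  open PermutationReasoning
  covers : edges Q ++ R ++ edges C ↭ allEdges (∞ ∷ U)
  covers = begin
    edges Q ++ R ++ edges C         ↭⟨ ++⁺ˡ (edges Q) p ⟩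
    edges Q ++ map (edge ∞) U ++ _  ↭⟨ shifts (edges Q) (map (edge ∞) U) ⟩
    map (edge ∞) U ++ edges Q ++ _  ↭⟨ ++⁺ˡ (map (edge ∞) U) (unique-⊆⇒↭ Q! (allEdges-unique U!) Q⊆U) ⟩
    allEdges (∞ ∷ U)                ∎
  length-covers : length (allEdges (∞ ∷ U)) ≡ length (edges Q) + (length (edges C) + length R)
  length-covers = trans (sym (↭-length covers)) (trans (length-++ (edges Q))
    (cong (length (edges Q) +_) (trans (length-++ R) (+-comm (length R) _))))
  paired : ∃[ D ] edges D ↭ R
  paired = pairUp-even R-star
    -- Taking the edges of `Q` and of `C`, two for each cherry, off the even total leaves an even
    -- number for `R`.
    (∣m+n∣m⇒∣n (∣m+n∣m⇒∣n (subst (2 ∣_) length-covers even) (2∣length-edges Q)) (2∣length-edges C))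
  D = proj₁ paired

-- Cherries as subgraphs

record _◂_ (c : Cherry) (G : Graph) : Set where
  field
    left-edge  : Edge G (centre c) (left c)
    right-edge : Edge G (centre c) (right c)
    left≢right : left c ≢ right c

open _◂_

cherryVertices : Cherry → List ℕ
cherryVertices c = left c ∷ centre c ∷ right c ∷ []

◂⇒unique : ∀ {c} G → c ◂ G → Unique (cherryVertices c)
◂⇒unique G c◂G =
  ((λ l≡c → irrefl G (sym l≡c) (left-edge c◂G)) ∷ left≢right c◂G ∷ []) ∷
  ((λ c≡r → irrefl G c≡r (right-edge c◂G)) ∷ []) ∷ [] ∷ []

-- Adjacency is membership in `cherryEdges`, so that facts about lists of edges carry over directly
-- to the blocks of a design.
cherryGraph : ∀ c → Unique (cherryVertices c) → Graph
cherryGraph c c! = record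
  { vertices = cherryVertices c , c!
  ; Edge     = λ x y → edge x y ∈ cherryEdges c
  ; edge?    = λ x y → edge x y ∈? cherryEdges c
  ; symm     = λ {x} {y} → subst (_∈ cherryEdges c) (edge-comm x y)
  ; irrefl   = λ { refl e → noLoop c! e }
  ; support  = λ e → endpoint e
  }
  where
  noLoop : ∀ {c x} → Unique (cherryVertices c) → edge x x ∉ cherryEdges c
  noLoop ((l≢c ∷ _) ∷ _) (here eq) with edge-injective eq
  ... | inj₁ (refl , refl) = l≢c refl
  ... | inj₂ (refl , refl) = l≢c refl
  noLoop (_ ∷ (c≢r ∷ []) ∷ _) (there (here eq)) with edge-injective eq
  ... | inj₁ (refl , refl) = c≢r refl
  ... | inj₂ (refl , refl) = c≢r refl
  endpoint : ∀ {x y} → edge x y ∈ cherryEdges c → x ∈ cherryVertices c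
  endpoint (here eq) with edge-injective eq
  ... | inj₁ (refl , _) = there (here refl)
  ... | inj₂ (refl , _) = here refl
  endpoint (there (here eq)) with edge-injective eq
  ... | inj₁ (refl , _) = there (here refl)
  ... | inj₂ (refl , _) = there (there (here refl))

cherryEdges-edge : ∀ {c e} → e ∈ cherryEdges c → ∃₂ λ x y → e ≡ edge x y
cherryEdges-edge (here refl)         = _ , _ , refl
cherryEdges-edge (there (here refl)) = _ , _ , refl

◂-edge : ∀ {c} G → c ◂ G → ∀ {x y} → edge x y ∈ cherryEdges c → Edge G x y
◂-edge G c◂G (here eq)         = Edge-resp-edge G (sym eq) (left-edge c◂G)
◂-edge G c◂G (there (here eq)) = Edge-resp-edge G (sym eq) (right-edge c◂G)

◂⇒edges-unique : ∀ {c G} → c ◂ G → Unique (cherryEdges c)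
◂⇒edges-unique c◂G = ((left≢right c◂G ∘ edge-injectiveʳ) ∷ []) ∷ [] ∷ []

cherryGraph-⊑ : ∀ {c} G (c! : Unique (cherryVertices c)) → c ◂ G → cherryGraph c c! ⊑ G
cherryGraph-⊑ {c} G c! c◂G = record { vertices⊆ = vertices⊆ ; edges⊆ = ◂-edge G c◂G }
  where
  vertices⊆ : cherryVertices c ⊆ V G
  vertices⊆ (here refl)                 = support G (symm G (left-edge c◂G))
  vertices⊆ (there (here refl))         = support G (left-edge c◂G)
  vertices⊆ (there (there (here refl))) = support G (symm G (right-edge c◂G))

P₃≅cherryGraph : ∀ c (c! : Unique (cherryVertices c)) → P₃ ≅ cherryGraph c c!
P₃≅cherryGraph (cherry l c r) c!@((l≢c ∷ l≢r ∷ []) ∷ (c≢r ∷ []) ∷ _) = record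
  { to        = to
  ; from      = from
  ; to-∈      = λ { (here refl)                 → here refl
                  ; (there (here refl))         → there (here refl)
                  ; (there (there (here refl))) → there (there (here refl)) }
  ; from-∈    = λ {x} _ → from-∈ x
  ; from∘to   = λ { (here refl)                 → from-l
                  ; (there (here refl))         → from-c
                  ; (there (there (here refl))) → from-r }
  ; to∘from   = λ { (here refl)                 → cong to from-l
                  ; (there (here refl))         → cong to from-c
                  ; (there (there (here refl))) → cong to from-r }
  ; to-edge   = λ { 0-1 → here (edge-comm l c)
                  ; 1-0 → here refl
                  ; 1-2 → there (here refl)
                  ; 2-1 → there (here (edge-comm r c)) }
  ; from-edge = from-edge
  }
  where
  to : ℕ → ℕ
  to 0 = l
  to 1 = c
  to _ = r
  from : ℕ → ℕ
  from x with x ≟ l | x ≟ c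
  ... | yes _ | _     = 0
  ... | no _  | yes _ = 1
  -- The default case takes in `r` along with all numbers outside the cherry, so the values lie in
  -- `V P₃` throughout.
  ... | no _  | no _  = 2
  from-∈ : ∀ x → from x ∈ V P₃
  from-∈ x with x ≟ l | x ≟ c
  ... | yes _ | _     = here refl
  ... | no _  | yes _ = there (here refl)
  ... | no _  | no _  = there (there (here refl))
  from-l : from l ≡ 0
  from-l with l ≟ l
  ... | yes _  = refl
  ... | no l≢l = contradiction refl l≢l
  from-c : from c ≡ 1
  from-c with c ≟ l | c ≟ c
  ... | yes refl | _      = contradiction refl l≢c
  ... | no _     | yes _  = refl
  ... | no _     | no c≢c = contradiction refl c≢c
  from-r : from r ≡ 2
  from-r with r ≟ l | r ≟ c
  ... | yes refl | _        = contradiction refl l≢r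
  ... | no _     | yes refl = contradiction refl c≢r
  ... | no _     | no _     = refl
  from-edge : ∀ {x y} → edge x y ∈ cherryEdges (cherry l c r) → P₃-Edge (from x) (from y)
  from-edge (here eq) with edge-injective eq
  ... | inj₁ (refl , refl) rewrite from-c | from-l = 1-0
  ... | inj₂ (refl , refl) rewrite from-c | from-l = 0-1
  from-edge (there (here eq)) with edge-injective eq
  ... | inj₁ (refl , refl) rewrite from-c | from-r = 1-2
  ... | inj₂ (refl , refl) rewrite from-c | from-r = 2-1

-- Designs from decompositions into cherries

Unique-++⁻ : ∀ {a} {A : Set a} (xs : List A) {ys} →
             Unique (xs ++ ys) → Unique xs × Unique ys × Disjoint xs ys
Unique-++⁻ []       ys!      = [] , ys! , λ ()
Unique-++⁻ (x ∷ xs) (x∉ ∷ u) with xs! , ys! , xs#ys ← Unique-++⁻ xs u =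
  All.++⁻ˡ xs x∉ ∷ xs! , ys! , λ
  { (here refl , x∈ys)  → All.lookup x∉ (∈-++⁺ʳ xs x∈ys) refl
  ; (there z∈xs , z∈ys) → xs#ys (z∈xs , z∈ys) }

module _ {a b} {A : Set a} {B : Set b} (f : A → List B) where

  Unique-concatMap⁻ : ∀ xs → Unique (concatMap f xs) → ∀ i → Unique (f (lookup xs i))
  Unique-concatMap⁻ (x ∷ xs) u zero    = proj₁ (Unique-++⁻ (f x) u)
  Unique-concatMap⁻ (x ∷ xs) u (suc i) = Unique-concatMap⁻ xs (proj₁ (proj₂ (Unique-++⁻ (f x) u))) i

  -- If `y` came from two different entries, it would occur twice in the concatenation. For
  -- `cherryEdges` this says that an edge determines its block.
  index-unique : ∀ xs → Unique (concatMap f xs) →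
                 ∀ {i j y} → y ∈ f (lookup xs i) → y ∈ f (lookup xs j) → i ≡ j
  index-unique (x ∷ xs) u {i} {j} p q with _ , u′ , fx#rest ← Unique-++⁻ (f x) u with i | j
  ... | zero   | zero   = refl
  ... | zero   | suc j′ = contradiction (p , ∈-concatMap⁺ f (lose (∈-lookup {xs = xs} j′) q)) fx#rest
  ... | suc i′ | zero   = contradiction (q , ∈-concatMap⁺ f (lose (∈-lookup {xs = xs} i′) p)) fx#rest
  ... | suc i′ | suc j′ = cong suc (index-unique xs u′ p q)

module CherryDesign (W : FinSet) (L : List Cherry) (L↭ : edges L ↭ allEdges (elements W)) where

  edges-unique : Unique (edges L)
  edges-unique = Unique-resp-↭ (setoid _) (↭⇒↭ₛ (↭-sym L↭)) (allEdges-unique (unique W))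

  lookup-◂ : ∀ i → lookup L i ◂ K[ W ]
  lookup-◂ i = record
    { left-edge  = inK (here refl)
    ; right-edge = inK (there (here refl))
    ; left≢right = left≢right′ (Unique-concatMap⁻ cherryEdges L edges-unique i)
    }
    where
    left≢right′ : ∀ {c} → Unique (cherryEdges c) → left c ≢ right c
    left≢right′ {c} ((l≢r ∷ []) ∷ _) l≡r = l≢r (cong (edge (centre c)) l≡r)
    inK : ∀ {x y} → edge x y ∈ cherryEdges (lookup L i) → Edge K[ W ] x y
    inK e = ∈-allEdges⁻ (unique W) (∈-resp-↭ L↭ (∈-concatMap⁺ cherryEdges (lose (∈-lookup {xs = L} i) e)))

  lookup-unique : ∀ i → Unique (cherryVertices (lookup L i))
  lookup-unique i = ◂⇒unique K[ W ] (lookup-◂ i)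

  cherryBlock : Fin (length L) → Graph
  cherryBlock i = cherryGraph (lookup L i) (lookup-unique i)

  block-unique : ∀ {i j x y} → Edge (cherryBlock i) x y → Edge (cherryBlock j) x y → i ≡ j
  block-unique = index-unique cherryEdges L edges-unique

  cherryDesign : Design K[ W ] P₃
  cherryDesign = record
    { size      = length L
    ; block     = cherryBlock
    -- Equal blocks share the first edge of the cherry, and an edge lies in one block only.
    ; distinct  = λ {i} (i⊑j , _) → block-unique (here refl) (_⊑_.edges⊆ i⊑j (here refl))
    ; block⊑    = λ i → cherryGraph-⊑ K[ W ] (lookup-unique i) (lookup-◂ i)
    ; block≅    = λ i → P₃≅cherryGraph (lookup L i) (lookup-unique i)
    ; partition = λ (x∈ , y∈ , x≢y) →
        -- The permutation finds every edge of the complete graph in some cherry, whose place in `L`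
        -- names the block.
        let some = ∈-concatMap⁻ cherryEdges {xs = L} (∈-resp-↭ (↭-sym L↭) (∈-allEdges⁺ x∈ y∈ x≢y))
        in index some , lookup-index some , block-unique (lookup-index some)
    }

-- Linking a design through cherries in its blocks

cherryIn : ∀ {Γ G} → P₃ ≲ Γ → Γ ≅ G → ∃[ c ] c ◂ G
cherryIn {Γ} {G} (H , H⊑Γ , P₃≅H) Γ≅G = cherry (f 0) (f 1) (f 2) , record
  { left-edge  = f-edge 1-0
  ; right-edge = f-edge 1-2
  -- The ends stay apart because `g` recovers 0 and 2 from them.
  ; left≢right = λ f0≡f2 → contradiction (trans (sym (g∘f (here refl)))
                   (trans (cong g f0≡f2) (g∘f (there (there (here refl)))))) λ ()
  }
  where
  module P = _≅_ P₃≅H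
  module Q = _≅_ Γ≅G
  f g : ℕ → ℕ
  f = Q.to ∘ P.to
  g = P.from ∘ Q.from
  f-edge : ∀ {x y} → P₃-Edge x y → Edge G (f x) (f y)
  f-edge = Q.to-edge ∘ _⊑_.edges⊆ H⊑Γ ∘ P.to-edge
  g∘f : ∀ {x} → x ∈ V P₃ → g (f x) ≡ x
  g∘f x∈ = trans (cong P.from (Q.from∘to (_⊑_.vertices⊆ H⊑Γ (P.to-∈ x∈)))) (P.from∘to x∈)

extend : FinSet → FinSet
-- One more than the maximum is a fresh point; 0 is the value of the maximum on an empty list.
extend (W , W!) = suc (max 0 W) ∷ W , All.map (λ x≤max → >⇒≢ (s≤s x≤max)) (xs≤max 0 W) ∷ W!

-- Letting `U` exceed the points of the design leaves room for further points before `extend` adds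
-- `∞`. A block is sent to the cherry chosen in it, which survives in the completed list as a member
-- of `Q`.
links : ∀ {Γ v} → P₃ ≲ Γ → (𝓑 : DesignOfOrder Γ v) (U : FinSet) → elements (points 𝓑) ⊆ elements U →
        2 ∣ triangle (suc (card U)) → LinksTo 𝓑 (suc (card U))
links {Γ} P₃≲Γ 𝓑 U W⊆U even = record
  { points = extend U
  ; order  = refl
  ; design = cherryDesign
  } , (λ i → index (position i)) , 
      -- The cherry found at this index comes with its own proof that its vertices are distinct,
      -- whose type mentions the cherry. The motive therefore quantifies over `c!`.
      λ i → subst (λ c → (c! : Unique (cherryVertices c)) → cherryGraph c c! ⊑ block D i)
                  (lookup-index (position i))
                  (λ c! → cherryGraph-⊑ (block D i) c! (proj₂ (chosen i)))
                  (lookup-unique (index (position i)))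
  where
  D : Design K[ points 𝓑 ] Γ
  D = design 𝓑
  chosen : ∀ i → ∃[ c ] c ◂ block D i
  chosen i = cherryIn P₃≲Γ (block≅ D i)
  Q : List Cherry
  Q = tabulate (proj₁ ∘ chosen)
  Q-unique : Unique (edges Q)
  Q-unique = Unique.concat⁺
    (All.map⁺ (All.tabulate⁺ λ i → ◂⇒edges-unique (proj₂ (chosen i))))
    (AllPairs.map⁺ (AllPairs.tabulate⁺ disjoint))
    where
    disjoint : ∀ {i j} → i ≢ j →
               Disjoint (cherryEdges (proj₁ (chosen i))) (cherryEdges (proj₁ (chosen j)))
    disjoint {i} {j} i≢j (e∈i , e∈j)
      with x , y , refl ← cherryEdges-edge e∈i
      with xy∈i ← ◂-edge (block D i) (proj₂ (chosen i)) e∈i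
      -- `only` identifies every block containing the edge with the one that the partition assigns,
      -- so a shared edge forces `i` and `j` to agree.
      with _ , _ , only ← partition D (_⊑_.edges⊆ (block⊑ D i) xy∈i) =
      i≢j (trans (sym (only xy∈i)) (only (◂-edge (block D j) (proj₂ (chosen j)) e∈j)))
  Q⊆U : edges Q ⊆ allEdges (elements U)
  Q⊆U e∈Q
    with c , c∈Q , e∈c ← find (∈-concatMap⁻ cherryEdges {xs = Q} e∈Q)
    with i , refl ← ∈-tabulate⁻ c∈Q
    with x , y , refl ← cherryEdges-edge e∈c
    with x∈ , y∈ , x≢y ← _⊑_.edges⊆ (block⊑ D i) (◂-edge (block D i) (proj₂ (chosen i)) e∈c) =
    ∈-allEdges⁺ (W⊆U x∈) (W⊆U y∈) x≢y
  completion : ∃[ C ] edges (Q ++ C) ↭ allEdges (elements (extend U))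
  completion = complete {Q = Q} Q-unique (unique U) Q⊆U (subst (2 ∣_) (sym (length-allEdges (elements (extend U)))) even)
  open CherryDesign (extend U) (Q ++ proj₁ completion) (proj₂ completion)
  position : ∀ i → proj₁ (chosen i) ∈ Q ++ proj₁ completion
  position i = ∈-++⁺ˡ (∈-tabulate⁺ i)

-- Parity and the bound on the order

even-or-odd : ∀ n → 2 ∣ n ⊎ 2 ∣ suc n
even-or-odd zero    = inj₁ (2 ∣0)
even-or-odd (suc n) = [ inj₂ ∘ ∣m∣n⇒∣m+n ∣-refl , inj₁ ]′ (even-or-odd n)

-- Going from 1 + v to 3 + v points adds 2v + 3 edges, an odd number, so one of the two counts is
-- even.
triangle-even : ∀ v → 2 ∣ triangle (1 + v) ⊎ 2 ∣ triangle (3 + v)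
triangle-even v = map₂ (λ odd → subst (2 ∣_) (rearrange v (triangle (1 + v)))
                                  (∣m∣n⇒∣m+n (m∣m*n (1 + v)) odd))
                       (even-or-odd (triangle (1 + v)))
  where
  rearrange : ∀ v t → 2 * (1 + v) + suc t ≡ (2 + v) + ((1 + v) + t)
  rearrange = solve-∀

-- The choice between one and three new points depends on `v` alone, so a single `n` serves all
-- designs of order `v`, as `𝓛₂` demands.
𝓛₂-nearby : ∀ {Γ} → P₃ ≲ Γ → ∀ v → ∃[ n ] n ≤ v + 3 × 𝓛₂ Γ v n
𝓛₂-nearby P₃≲Γ v with triangle-even v
... | inj₁ even = 1 + v , ≤-trans (≤-reflexive (+-comm 1 v)) (+-monoʳ-≤ v (s≤s z≤n)) ,
  λ 𝓑 → subst (λ u → 2 ∣ triangle (1 + u) → LinksTo 𝓑 (1 + u)) (order 𝓑)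
    (links P₃≲Γ 𝓑 (points 𝓑) (λ x∈ → x∈)) even
... | inj₂ even = 3 + v , ≤-reflexive (+-comm 3 v) ,
  λ 𝓑 → subst (λ u → 2 ∣ triangle (3 + u) → LinksTo 𝓑 (3 + u)) (order 𝓑)
    -- Two of the three new points are added here; the third is the `∞` added inside `links`.
    (links P₃≲Γ 𝓑 (extend (extend (points 𝓑))) (λ x∈ → there (there x∈))) even

theorem4p2 : (Γ : Graph) → P₃ ≲ Γ →
    (v : ℕ) → 0 < v → DesignOfOrder Γ v →
    (η₁ η₂ : ℕ∞) → IsInfimum (𝓛₁ Γ v) η₁ → IsInfimum (𝓛₂ Γ v) η₂ →
    (η₁ ≤∞ η₂) × (η₂ ≤∞ [ v + 3 ])
theorem4p2 Γ P₃≲Γ v _ 𝓑 η₁ η₂ inf₁ inf₂ with n , n≤v+3 , n∈𝓛₂ ← 𝓛₂-nearby P₃≲Γ v =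
  -- The given design `𝓑` witnesses in `𝓛₁` every order that belongs to `𝓛₂`, so `η₁` is a lower
  -- bound of `𝓛₂`.
  IsInfimum.greatest inf₂ (λ m∈𝓛₂ → IsInfimum.lower inf₁ (𝓑 , m∈𝓛₂ 𝓑)) ,
  Sup.≤⁺-trans ≤-trans (IsInfimum.lower inf₂ n∈𝓛₂) Sup.[ n≤v+3 ]
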